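{- Let $G$ be a graph with at least one edge and let $H$ be a subdivision of $G$. Then $$\operatorname{diam}(H)\le \operatorname{diam}(G)+\log_2(\operatorname{diam}(G))+5 .$$
   Context: Graphs are finite and simple. For an oriented graph $\overrightarrow{G}$ and $X\subseteq V(\overrightarrow{G})$, the inversion of $X$ reverses every arc having both endpoints in $X$ (and no other arc). For a (labeled) graph $G$, the inversion distance between two orientations of $G$ is the minimum number of inversions transforming one into the other (equality as labeled oriented graphs), and the inversion diameter $\operatorname{diam}(G)$ is the maximum inversion distance over all pairs of orientations of $G$. A graph $H$ is a subdivision of $G$ if it can be obtained from $G$ by replacing every edge by a path on at least 2 vertices between its endpoints (paths are internally disjoint with new internal vertices; the lengths may differ for different edges, and an edge may be left unsubdivided). -}

module Defs where

open import Level using (0ℓ)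
open import Data.Bool.Base using (Bool; true; false; T; not; _∧_; if_then_else_)
open import Data.Bool.Properties using (T-≡; not-involutive; ¬-not)
  renaming (_≟_ to _≟ᵇ_)
open import Data.Empty using (⊥-elim)
open import Data.Fin.Base using (Fin; toℕ; combine; remQuot; _<_)
open import Data.Fin.Properties using (all?; remQuot-combine; <-cmp; _<?_)
open import Data.Fin.Subset using (Subset; _∈_; ⁅_⁆; _∪_)
open import Data.Fin.Subset.Properties
  using (_∈?_; anySubset?; x∈⁅x⁆; x∈⁅y⁆⇒x≡y; x∈p∪q⁻; x∈p∪q⁺)
open import Data.List.Base using (List; []; _∷_; allFin; cartesianProduct)
open import Data.List.Membership.Propositional using () renaming (_∈_ to _∈ˡ_)
open import Data.List.Membership.Propositional.Properties
  using (∈-cartesianProduct⁺; ∈-allFin)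
open import Data.List.Relation.Unary.Any using (here; there)
open import Data.Nat.Base using (ℕ; zero; suc; _*_; _≤_; z≤n; s≤s)
import Data.Nat.Properties as ℕ
open import Data.Product.Base using (Σ-syntax; ∃; ∃-syntax; _×_; _,_; proj₁; proj₂)
open import Data.Sum.Base using (_⊎_; inj₁; inj₂)
open import Data.Vec.Base using ([]; _∷_; lookup; tabulate)
open import Data.Vec.Properties using (lookup∘tabulate)
open import Function.Base using (_∘_)
open import Function.Bundles using (_⇔_; _↔_; Inverse; Equivalence)
open import Relation.Binary.Construct.Closure.Symmetric using (SymClosure)
open import Relation.Binary.Definitions using (tri<; tri≈; tri>)
open import Relation.Binary.PropositionalEquality
  using (_≡_; _≢_; refl; sym; trans; cong; subst)
open import Relation.Nullary.Decidable
  using (Dec; yes; no; does; _×-dec_; dec-true; dec-false)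
open import Relation.Nullary.Negation using (¬_; contradiction)
open import Relation.Unary using (Pred; Decidable)

record Graph : Set where
  field
    order   : ℕ
    adj     : Fin order → Fin order → Bool
    adj-sym : ∀ u v → adj u v ≡ adj v u
    no-loop : ∀ u → adj u u ≡ false

  Vertex : Set
  Vertex = Fin order

  -- Each edge is listed once, from its smaller to its larger end; both
  -- proofs are propositions, so equality of edges is equality of end pairs.
  record Edge : Set where
    field
      source target : Vertex
      ordered       : source < target
      adjacent      : T (adj source target)

open Graph using (order; adj; Vertex; Edge) public

record Orientation (G : Graph) : Set where
  field
    arc     : Vertex G → Vertex G → Bool
    arc⇒adj : ∀ u v → T (arc u v) → T (adj G u v)
    one-way : ∀ u v → T (adj G u v) → arc v u ≡ not (arc u v)

open Orientation public

module _ {G : Graph} where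

  infix 4 _≈_

  -- Equality as labelled oriented graphs: only the arcs are compared, not the
  -- proof fields.
  _≈_ : Orientation G → Orientation G → Set
  O ≈ P = ∀ u v → arc O u v ≡ arc P u v

  invert : Subset (order G) → Orientation G → Orientation G
  invert X O = record { arc = arc′ ; arc⇒adj = arc′⇒adj ; one-way = one-way′ }
    where
    arc′ : Vertex G → Vertex G → Bool
    arc′ u v = if does ((u ∈? X) ×-dec (v ∈? X)) then arc O v u else arc O u v

    arc′⇒adj : ∀ u v → T (arc′ u v) → T (adj G u v)
    arc′⇒adj u v with u ∈? X | v ∈? X
    ... | yes _ | yes _ = subst T (Graph.adj-sym G v u) ∘ arc⇒adj O v u
    ... | yes _ | no  _ = arc⇒adj O u v
    ... | no  _ | _     = arc⇒adj O u v

    one-way′ : ∀ u v → T (adj G u v) → arc′ v u ≡ not (arc′ u v)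
    one-way′ u v uv with u ∈? X | v ∈? X
    ... | yes _ | yes _ = one-way O v u (subst T (Graph.adj-sym G u v) uv)
    ... | yes _ | no  _ = one-way O u v uv
    ... | no  _ | yes _ = one-way O u v uv
    ... | no  _ | no  _ = one-way O u v uv

  Reach : ℕ → Orientation G → Orientation G → Set
  Reach zero    O P = O ≈ P
  Reach (suc k) O P = ∃[ X ] Reach k (invert X O) P

  IsDistance : Orientation G → Orientation G → ℕ → Set
  IsDistance O P d = Reach d O P × (∀ k → Reach k O P → d ≤ k)

IsDiameter : Graph → ℕ → Set
IsDiameter G D =
  (Σ[ O ∈ Orientation G ] Σ[ P ∈ Orientation G ] IsDistance O P D) ×
  (∀ (O P : Orientation G) d → IsDistance O P d → d ≤ D)

module _ {G : Graph} where

  private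
    true⇒T : ∀ {b} → b ≡ true → T b
    true⇒T = Equivalence.from T-≡

    nonarc : (O : Orientation G) → ∀ u v → adj G u v ≡ false → arc O u v ≡ false
    nonarc O u v uv with arc O u v in eq
    ... | false = refl
    ... | true  = ⊥-elim (subst T uv (arc⇒adj O u v (true⇒T eq)))

    reverse-differing : (O P : Orientation G) → ∀ a b → arc O a b ≢ arc P a b →
                        arc O b a ≡ arc P a b × arc O a b ≡ arc P b a
    reverse-differing O P a b ab≢ with adj G a b in eq
    ... | false = contradiction (trans (nonarc O a b eq) (sym (nonarc P a b eq))) ab≢
    ... | true  =
        trans (one-way O a b (true⇒T eq)) (trans (cong not O≡¬P) (not-involutive _))
      , trans O≡¬P (sym (one-way P a b (true⇒T eq)))
      where
      O≡¬P : arc O a b ≡ not (arc P a b)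
      O≡¬P = ¬-not ab≢

    ∈-pair : ∀ {a b u : Vertex G} → u ∈ ⁅ a ⁆ ∪ ⁅ b ⁆ → u ≡ a ⊎ u ≡ b
    ∈-pair {a} {b} u∈ with x∈p∪q⁻ ⁅ a ⁆ ⁅ b ⁆ u∈
    ... | inj₁ p = inj₁ (x∈⁅y⁆⇒x≡y a p)
    ... | inj₂ p = inj₂ (x∈⁅y⁆⇒x≡y b p)

    -- Repair the pairs in L one at a time, inverting a two-element set
    -- whenever O and P disagree.
    reach-off : (L : List (Vertex G × Vertex G)) (O P : Orientation G) →
                (∀ u v → arc O u v ≡ arc P u v ⊎ (u , v) ∈ˡ L) →
                ∃[ k ] Reach k O P
    reach-off [] O P agree = 0 , O≈P
      where
      O≈P : O ≈ P
      O≈P u v with agree u v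
      ... | inj₁ eq = eq
      ... | inj₂ ()
    reach-off ((a , b) ∷ L) O P agree with arc O a b ≟ᵇ arc P a b
    ... | yes ab≡ = reach-off L O P agree′
      where
      agree′ : ∀ u v → arc O u v ≡ arc P u v ⊎ (u , v) ∈ˡ L
      agree′ u v with agree u v
      ... | inj₁ eq           = inj₁ eq
      ... | inj₂ (here refl)  = inj₁ ab≡
      ... | inj₂ (there uv∈L) = inj₂ uv∈L
    ... | no ab≢ = let k , r = reach-off L (invert X O) P agree′ in suc k , X , r
      where
      X : Subset (order G)
      X = ⁅ a ⁆ ∪ ⁅ b ⁆

      loop : ∀ u → arc O u u ≡ arc P u u
      loop u = trans (nonarc O u u (Graph.no-loop G u))
                     (sym (nonarc P u u (Graph.no-loop G u)))

      a∈X : a ∈ X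
      a∈X = x∈p∪q⁺ (inj₁ (x∈⁅x⁆ a))

      b∈X : b ∈ X
      b∈X = x∈p∪q⁺ (inj₂ (x∈⁅x⁆ b))

      inside : ∀ {u v} → u ≡ a ⊎ u ≡ b → v ≡ a ⊎ v ≡ b → arc O v u ≡ arc P u v
      inside (inj₁ refl) (inj₁ refl) = loop a
      inside (inj₁ refl) (inj₂ refl) = proj₁ (reverse-differing O P a b ab≢)
      inside (inj₂ refl) (inj₁ refl) = proj₂ (reverse-differing O P a b ab≢)
      inside (inj₂ refl) (inj₂ refl) = loop b

      outside : ∀ u v → ¬ (u ∈ X × v ∈ X) → arc O u v ≡ arc P u v ⊎ (u , v) ∈ˡ L
      outside u v ∉X with agree u v
      ... | inj₁ eq           = inj₁ eq
      ... | inj₂ (here refl)  = contradiction (a∈X , b∈X) ∉X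
      ... | inj₂ (there uv∈L) = inj₂ uv∈L

      agree′ : ∀ u v → arc (invert X O) u v ≡ arc P u v ⊎ (u , v) ∈ˡ L
      agree′ u v with u ∈? X | v ∈? X
      ... | yes u∈X | yes v∈X = inj₁ (inside (∈-pair u∈X) (∈-pair v∈X))
      ... | yes _   | no  v∉X = outside u v (v∉X ∘ proj₂)
      ... | no  u∉X | _       = outside u v (u∉X ∘ proj₁)

    reachable : (O P : Orientation G) → ∃[ k ] Reach k O P
    reachable O P = reach-off (cartesianProduct (allFin _) (allFin _)) O P
      (λ u v → inj₂ (∈-cartesianProduct⁺ (∈-allFin u) (∈-allFin v)))

    reach? : ∀ k (O P : Orientation G) → Dec (Reach k O P)
    reach? zero    O P = all? (λ u → all? (λ v → arc O u v ≟ᵇ arc P u v))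
    reach? (suc k) O P = anySubset? (λ X → reach? k (invert X O) P)

    least : {Q : Pred ℕ 0ℓ} → Decidable Q → ∀ n → Q n →
            ∃[ m ] Q m × (∀ k → Q k → m ≤ k)
    least     Q? zero    q = 0 , q , λ _ _ → z≤n
    least {Q} Q? (suc n) q with Q? 0
    ... | yes q₀ = 0 , q₀ , λ _ _ → z≤n
    ... | no ¬q₀ = let m , qm , min = least (Q? ∘ suc) n q in suc m , qm , bound min
      where
      bound : ∀ {m} → (∀ k → Q (suc k) → m ≤ k) → ∀ k → Q k → suc m ≤ k
      bound min zero    q₀ = contradiction q₀ ¬q₀
      bound min (suc k) qk = s≤s (min k qk)

  distance-exists : (O P : Orientation G) → ∃ (IsDistance O P)
  distance-exists O P = let k , r = reachable O P in least (λ j → reach? j O P) k r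

  private
    ≈-invert : ∀ X {O O′ : Orientation G} → O ≈ O′ → invert X O ≈ invert X O′
    ≈-invert X O≈O′ u v with u ∈? X | v ∈? X
    ... | yes _ | yes _ = O≈O′ v u
    ... | yes _ | no  _ = O≈O′ u v
    ... | no  _ | _     = O≈O′ u v

    reach-resp : ∀ k {O O′ P P′ : Orientation G} → O ≈ O′ → P ≈ P′ →
                 Reach k O P → Reach k O′ P′
    reach-resp zero    O≈ P≈ r u v   = trans (sym (O≈ u v)) (trans (r u v) (P≈ u v))
    reach-resp (suc k) {O} {O′} {P} {P′} O≈ P≈ (X , r) =
      X , reach-resp k {invert X O} {invert X O′} {P} {P′}
            (≈-invert X {O} {O′} O≈) P≈ r

    Code : Set
    Code = Subset (order G * order G)

    decode : Code → Orientation G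
    decode S = record { arc = arc′ ; arc⇒adj = arc′⇒adj ; one-way = one-way′ }
      where
      s : Vertex G → Vertex G → Bool
      s u v = lookup S (combine u v)

      arc′ : Vertex G → Vertex G → Bool
      arc′ u v = adj G u v ∧ (if does (u <? v) then s u v else not (s v u))

      arc′⇒adj : ∀ u v → T (arc′ u v) → T (adj G u v)
      arc′⇒adj u v t with adj G u v
      ... | true = _

      one-way′ : ∀ u v → T (adj G u v) → arc′ v u ≡ not (arc′ u v)
      one-way′ u v uv rewrite Graph.adj-sym G v u with adj G u v in eq
      ... | true with <-cmp u v
      ...   | tri< p _ ¬q rewrite dec-true (u <? v) p | dec-false (v <? u) ¬q = refl
      ...   | tri> ¬p _ q rewrite dec-false (u <? v) ¬p | dec-true (v <? u) q =
              sym (not-involutive _)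
      ...   | tri≈ _ refl _ with () ← trans (sym eq) (Graph.no-loop G u)

    encode : Orientation G → Code
    encode O = tabulate (λ i → let u , v = remQuot (order G) i in arc O u v)

    lookup-encode : ∀ O u v → lookup (encode O) (combine u v) ≡ arc O u v
    lookup-encode O u v = trans
      (lookup∘tabulate _ (combine u v))
      (cong (λ (u , v) → arc O u v) (remQuot-combine u v))

    decode-encode : ∀ O → decode (encode O) ≈ O
    decode-encode O u v with adj G u v in eq
    ... | false = sym (nonarc O u v eq)
    ... | true with does (u <? v)
    ...   | true  = lookup-encode O u v
    ...   | false = trans
      (cong not (trans (lookup-encode O v u) (one-way O u v (true⇒T eq))))
      (not-involutive _)

    argmax : ∀ m (f : Subset m → ℕ) → ∃[ S ] (∀ R → f R ≤ f S)
    argmax zero    f = [] , λ { [] → ℕ.≤-refl }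
    argmax (suc m) f with argmax m (f ∘ (true ∷_)) | argmax m (f ∘ (false ∷_))
    ... | S , maxS | R , maxR with ℕ.≤-total (f (true ∷ S)) (f (false ∷ R))
    ...   | inj₁ le = false ∷ R , λ where
      (true  ∷ Q) → ℕ.≤-trans (maxS Q) le
      (false ∷ Q) → maxR Q
    ...   | inj₂ ge = true ∷ S , λ where
      (true  ∷ Q) → maxS Q
      (false ∷ Q) → ℕ.≤-trans (maxR Q) ge

    dist : Code → Code → ℕ
    dist S R = proj₁ (distance-exists (decode S) (decode R))

  diameter-exists : ∃ (IsDiameter G)
  diameter-exists = dist S (best S) , (decode S , decode (best S) ,
                    proj₂ (distance-exists (decode S) (decode (best S)))) , bound
    where
    best : Code → Code
    best R = proj₁ (argmax _ (dist R))

    S : Code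
    S = proj₁ (argmax _ (λ R → dist R (best R)))

    bound : ∀ O P d → IsDistance O P d → d ≤ dist S (best S)
    bound O P d (_ , min) = ℕ.≤-trans
      (min _ (reach-resp (dist R Q) {decode R} {O} {decode Q} {P}
        (decode-encode O) (decode-encode P)
        (proj₁ (proj₂ (distance-exists (decode R) (decode Q))))))
      (ℕ.≤-trans (proj₂ (argmax _ (dist R)) Q)
                 (proj₂ (argmax _ (λ R → dist R (best R))) R))
      where
      R Q : Code
      R = encode O
      Q = encode P

-- Characterised by proj₂ (diameter-exists {G}) : IsDiameter G (diam G).
diam : Graph → ℕ
diam G = proj₁ (diameter-exists {G})

module _ (G : Graph) (len : Edge G → ℕ) where

  -- The vertices of G together with len e new ones for every edge e.
  SubdividedVertex : Set
  SubdividedVertex = Vertex G ⊎ (Σ[ e ∈ Edge G ] Fin (len e))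

  -- The edges of the paths  source e, (e , 0), …, (e , len e ∸ 1), target e,
  -- each taken in the direction of its path.
  data PathStep : SubdividedVertex → SubdividedVertex → Set where
    whole : ∀ e → len e ≡ 0 →
            PathStep (inj₁ (Edge.source e)) (inj₁ (Edge.target e))
    first : ∀ e (i : Fin (len e)) → toℕ i ≡ 0 →
            PathStep (inj₁ (Edge.source e)) (inj₂ (e , i))
    next  : ∀ e (i j : Fin (len e)) → toℕ j ≡ suc (toℕ i) →
            PathStep (inj₂ (e , i)) (inj₂ (e , j))
    last  : ∀ e (i : Fin (len e)) → suc (toℕ i) ≡ len e →
            PathStep (inj₂ (e , i)) (inj₁ (Edge.target e))

-- H is, up to renaming of vertices, the graph obtained from G by replacing
-- every edge e by a path with len e internal vertices.
record IsSubdivision (G H : Graph) : Set where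
  field
    len      : Edge G → ℕ
    vertices : SubdividedVertex G len ↔ Vertex H
    edges    : ∀ x y → T (adj H (Inverse.to vertices x) (Inverse.to vertices y)) ⇔
                       SymClosure (PathStep G len) x y

{-# OPTIONS --safe #-}
-- Reading the sets of a sequence of k inversions as coordinates turns it into
-- a map f : V → 𝔽₂ᵏ, and the sequence reverses an arc uv iff f u · f v = 1.
-- So diam G ≤ t iff every labelling of the edges of G is u v ↦ f u · f v for
-- some f : V → 𝔽₂ᵗ.  Put t = diam G.  Counting labellings against maps f
-- bounds the minimum degree of every induced subgraph by 2t, hence G has a
-- proper colouring by vectors h v of length ⌊log₂ t⌋ + 2.  The subdivision is
-- realised by v ↦ (1,0,0,h v,g v) on the old vertices, where g realises on G
-- the prescribed labels corrected by 1 + h u · h v.  A single new vertex on an edge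
-- uv can be placed since h u ≠ h v; on longer paths the new vertices are
-- placed one by one among the vectors (x₀,x₁,x₂,0) with (x₁,x₂) ≠ (0,0),
-- where x₀ is the product with the end of the path.
module Submission where

open import Defs
open import Data.Bool.Base using (Bool; true; false; T; not; _∧_; _∨_; _xor_; if_then_else_)
open import Data.Bool.Properties
  using (T?; ∧-comm; xor-assoc; xor-comm; xor-same; xor-identityʳ;
         not-involutive; xor-annihilates-not)
open import Data.Fin.Base using (Fin; zero; suc; toℕ; punchIn; punchOut)
open import Data.Fin.Properties
  using (_≟_; _<?_; <-cmp; any?; 2↔Bool; *↔×; injective⇒≤; punchIn-punchOut)
open import Data.Fin.Subset using (Subset)
open import Data.Fin.Subset.Properties using (_∈?_)
open import Data.Nat using (ℕ; zero; suc; _+_; _^_; _≤_; _<_; z≤n; s≤s)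
open import Data.Nat.Logarithm using (⌊log₂_⌋; ⌊log₂⌋-mono-≤; ⌊log₂[2^n]⌋≡n)
import Data.Nat.Properties as ℕ
open import Data.Nat.Solver using (module +-*-Solver)
open import Data.Product.Base using (Σ-syntax; ∃-syntax; _×_; _,_; proj₁; proj₂; uncurry)
open import Data.Product.Function.NonDependent.Propositional using (_×-↔_)
open import Data.Sum.Base using (inj₁; inj₂)
open import Data.Unit.Base using (tt)
open import Data.Vec.Base
  using (Vec; []; _∷_; _++_; head; tail; lookup; tabulate; replicate; padRight)
open import Data.Vec.Functional using (insertAt)
open import Data.Vec.Functional.Properties using (insertAt-lookup; insertAt-punchIn)
open import Data.Vec.Properties
  using (++-injectiveˡ; ++-injectiveʳ; tabulate∘lookup; lookup∘tabulate; tabulate-cong)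
open import Function.Base using (_∘_; flip; id)
open import Function.Bundles using (_↔_; Inverse; Injection; Equivalence; mk↔ₛ′)
open import Function.Construct.Composition using (_↔-∘_)
open import Function.Construct.Symmetry using (↔-sym)
open import Function.Properties.Inverse using (↔⇒↣)
open import Relation.Binary.Construct.Closure.Symmetric using (SymClosure; fwd; bwd)
open import Relation.Binary.Definitions using (tri<; tri≈; tri>)
open import Relation.Binary.PropositionalEquality
  using (_≡_; _≢_; refl; sym; trans; cong; cong₂; subst; module ≡-Reasoning)
open import Relation.Nullary.Decidable
  using (Dec; yes; no; does; _×-dec_; ¬?; decidable-stable; dec-true; dec-false)
open import Relation.Nullary.Negation using (¬_; contradiction)

private
  variable
    k m n s t : ℕ

-- Linear algebra over 𝔽₂

xor-cancelˡ : ∀ x y → x xor (x xor y) ≡ y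
xor-cancelˡ true  y = not-involutive y
xor-cancelˡ false y = refl

xor-cancelʳ : ∀ x y → (x xor y) xor y ≡ x
xor-cancelʳ x y = trans (xor-assoc x y y) (trans (cong (x xor_) (xor-same y)) (xor-identityʳ x))

infix 7 _·_

_·_ : Vec Bool n → Vec Bool n → Bool
[]      · []      = false
(x ∷ v) · (y ∷ w) = (x ∧ y) xor (v · w)

·-comm : (v w : Vec Bool n) → v · w ≡ w · v
·-comm []      []      = refl
·-comm (x ∷ v) (y ∷ w) = cong₂ _xor_ (∧-comm x y) (·-comm v w)

𝟎 : Vec Bool n
𝟎 = replicate _ false

·-zeroʳ : (v : Vec Bool n) → v · 𝟎 ≡ false
·-zeroʳ []          = refl
·-zeroʳ (true  ∷ v) = ·-zeroʳ v
·-zeroʳ (false ∷ v) = ·-zeroʳ v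

·-++ : (v v′ : Vec Bool m) (w w′ : Vec Bool n) →
       (v ++ w) · (v′ ++ w′) ≡ (v · v′) xor (w · w′)
·-++ []      []        w w′ = refl
·-++ (x ∷ v) (x′ ∷ v′) w w′ =
  trans (cong ((x ∧ x′) xor_) (·-++ v v′ w w′)) (sym (xor-assoc (x ∧ x′) _ _))

·-padRight : (m≤n : m ≤ n) (v w : Vec Bool m) →
             padRight m≤n false v · padRight m≤n false w ≡ v · w
·-padRight {n = n} z≤n [] []         = ·-zeroʳ {n} 𝟎
·-padRight (s≤s m≤n) (x ∷ v) (y ∷ w) = cong ((x ∧ y) xor_) (·-padRight m≤n v w)

-- The witness carries `c` at the first coordinate where `v` and `w` differ and is zero elsewhere,
-- so exactly one of the two products picks up `c`.
·-separates : (v w : Vec Bool n) → v ≢ w → ∀ c → ∃[ x ] (v · x) xor (w · x) ≡ c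
·-separates []          []          v≢w c = contradiction refl v≢w
·-separates (true ∷ v)  (true ∷ w)  v≢w c =
  let x , eq = ·-separates v w (v≢w ∘ cong (true ∷_)) c in false ∷ x , eq
·-separates (false ∷ v) (false ∷ w) v≢w c =
  let x , eq = ·-separates v w (v≢w ∘ cong (false ∷_)) c in false ∷ x , eq
·-separates (true ∷ v)  (false ∷ w) v≢w c = c ∷ 𝟎 ,
  trans (cong₂ (λ p q → (c xor p) xor q) (·-zeroʳ v) (·-zeroʳ w))
        (trans (xor-identityʳ _) (xor-identityʳ c))
·-separates (false ∷ v) (true ∷ w)  v≢w c = c ∷ 𝟎 ,
  trans (cong₂ (λ p q → p xor (c xor q)) (·-zeroʳ v) (·-zeroʳ w)) (xor-identityʳ c)

Adjacency : ℕ → Set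
Adjacency n = Fin n → Fin n → Bool

Symmetric : Adjacency n → Set
Symmetric σ = ∀ u v → σ u v ≡ σ v u

Realizes : ℕ → Adjacency n → Adjacency n → Set
Realizes {n} t A σ = Σ[ f ∈ (Fin n → Vec Bool t) ] (∀ u v → T (A u v) → f u · f v ≡ σ u v)

Realizable : ℕ → Adjacency n → Set
Realizable t A = ∀ σ → Symmetric σ → Realizes t A σ

-- Inversions as coordinates

does-∈? : ∀ (u : Fin n) X → does (u ∈? X) ≡ lookup X u
does-∈? zero    (true  ∷ X) = refl
does-∈? zero    (false ∷ X) = refl
does-∈? (suc u) (x ∷ X)     = does-∈? u X

if-not : ∀ b x → (if b then not x else x) ≡ x xor b
if-not true  true  = refl
if-not true  false = refl
if-not false x     = sym (xor-identityʳ x)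

module _ {G : Graph} where

  arc-nonadjacent : (O : Orientation G) → ∀ u v → ¬ T (adj G u v) → arc O u v ≡ false
  arc-nonadjacent O u v ¬uv with arc O u v in eq
  ... | false = refl
  ... | true  = contradiction (arc⇒adj O u v (subst T (sym eq) tt)) ¬uv

  -- On an edge, exchanging the two directions is negation, so an inversion adds the product of the
  -- two membership bits modulo 2.
  arc-invert : ∀ X (O : Orientation G) u v → T (adj G u v) →
               arc (invert X O) u v ≡ arc O u v xor (lookup X u ∧ lookup X v)
  arc-invert X O u v uv
    rewrite does-∈? u X | does-∈? v X | one-way O u v uv =
    if-not (lookup X u ∧ lookup X v) (arc O u v)

  reach⇒realizes : ∀ k (O P : Orientation G) → Reach k O P →
                   Realizes k (adj G) (λ u v → arc O u v xor arc P u v)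
  reach⇒realizes zero O P O≈P = (λ _ → []) , λ u v _ →
    sym (trans (cong (_xor arc P u v) (O≈P u v)) (xor-same (arc P u v)))
  reach⇒realizes (suc k) O P (X , r) =
    let f , f-realizes = reach⇒realizes k (invert X O) P r in
    (λ u → lookup X u ∷ f u) , λ u v uv → begin
      (lookup X u ∧ lookup X v) xor (f u · f v)
        ≡⟨ cong ((lookup X u ∧ lookup X v) xor_)
             (trans (f-realizes u v uv) (cong (_xor arc P u v) (arc-invert X O u v uv))) ⟩
      (lookup X u ∧ lookup X v) xor ((arc O u v xor (lookup X u ∧ lookup X v)) xor arc P u v)
        ≡⟨ regroup (lookup X u ∧ lookup X v) (arc O u v) (arc P u v) ⟩
      arc O u v xor arc P u v ∎
    where
    open ≡-Reasoning
    regroup : ∀ x o p → x xor ((o xor x) xor p) ≡ o xor p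
    regroup x o p = trans (cong (λ y → x xor (y xor p)) (xor-comm o x))
      (trans (cong (x xor_) (xor-assoc x o p)) (xor-cancelˡ x (o xor p)))

  realizes⇒reach : ∀ k (O P : Orientation G) →
                   Realizes k (adj G) (λ u v → arc O u v xor arc P u v) → Reach k O P
  realizes⇒reach zero O P (f , f-realizes) u v with T? (adj G u v)
  ... | no ¬uv = trans (arc-nonadjacent O u v ¬uv) (sym (arc-nonadjacent P u v ¬uv))
  ... | yes uv with [] ← f u | [] ← f v | eq ← f-realizes u v uv =
    trans (sym (xor-identityʳ _))
          (trans (cong (arc O u v xor_) eq) (xor-cancelˡ (arc O u v) (arc P u v)))
  realizes⇒reach (suc k) O P (f , f-realizes) =
    X , realizes⇒reach k (invert X O) P (tail ∘ f , tail-realizes)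
    where
    -- The first coordinates name the first set to invert; the tails must then realise what still
    -- differs.
    X : Subset (order G)
    X = tabulate (head ∘ f)

    ·-split : (v w : Vec Bool (suc k)) → v · w ≡ (head v ∧ head w) xor (tail v · tail w)
    ·-split (_ ∷ _) (_ ∷ _) = refl

    tail-realizes : ∀ u v → T (adj G u v) →
                    tail (f u) · tail (f v) ≡ arc (invert X O) u v xor arc P u v
    tail-realizes u v uv = begin
      tail (f u) · tail (f v)                ≡⟨ xor-cancelˡ x _ ⟨
      x xor (x xor (tail (f u) · tail (f v))) ≡⟨ cong (x xor_) (·-split (f u) (f v)) ⟨
      x xor (f u · f v)                      ≡⟨ cong (x xor_) (f-realizes u v uv) ⟩
      x xor (arc O u v xor arc P u v)        ≡⟨ xor-assoc x _ _ ⟨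
      (x xor arc O u v) xor arc P u v        ≡⟨ cong (_xor arc P u v) (xor-comm x _) ⟩
      (arc O u v xor x) xor arc P u v        ≡⟨ cong (λ y → (arc O u v xor y) xor arc P u v)
                                                  (cong₂ _∧_ (lookup∘tabulate (head ∘ f) u)
                                                             (lookup∘tabulate (head ∘ f) v)) ⟨
      (arc O u v xor (lookup X u ∧ lookup X v)) xor arc P u v
        ≡⟨ cong (_xor arc P u v) (arc-invert X O u v uv) ⟨
      arc (invert X O) u v xor arc P u v     ∎
      where
      open ≡-Reasoning
      x : Bool
      x = head (f u) ∧ head (f v)

  -- Labels are deviations from the orientation of every edge towards its larger end, so the
  -- constant label `false` is a reference from which `σ` is read off as a difference.
  orientation : ∀ σ → Symmetric σ → Orientation G
  orientation σ σ-sym = record { arc = arc′ ; arc⇒adj = arc′⇒adj ; one-way = one-way′ }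
    where
    arc′ : Vertex G → Vertex G → Bool
    arc′ u v = adj G u v ∧ (does (u <? v) xor σ u v)

    arc′⇒adj : ∀ u v → T (arc′ u v) → T (adj G u v)
    arc′⇒adj u v t with adj G u v
    ... | true = _

    one-way′ : ∀ u v → T (adj G u v) → arc′ v u ≡ not (arc′ u v)
    one-way′ u v uv rewrite Graph.adj-sym G v u | σ-sym v u with adj G u v in eq
    ... | true with <-cmp u v
    ...   | tri< p _ ¬q rewrite dec-true (u <? v) p | dec-false (v <? u) ¬q =
            sym (not-involutive _)
    ...   | tri> ¬p _ q rewrite dec-false (u <? v) ¬p | dec-true (v <? u) q = refl
    ...   | tri≈ _ refl _ with () ← trans (sym eq) (Graph.no-loop G u)

  diameter-realizable : ∀ {D} → IsDiameter G D → Realizable D (adj G)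
  -- The distance `d` may be smaller than `D`; zero coordinates fill the gap without changing any
  -- product.
  diameter-realizable {D} (_ , farthest) σ σ-sym = padRight d≤D false ∘ f , λ u v uv →
    trans (·-padRight d≤D (f u) (f v)) (trans (f-realizes u v uv) (difference u v uv))
    where
    O P : Orientation G
    O = orientation (λ _ _ → false) (λ _ _ → refl)
    P = orientation σ σ-sym

    d : ℕ
    d = proj₁ (distance-exists O P)

    d-distance : IsDistance O P d
    d-distance = proj₂ (distance-exists O P)

    d≤D : d ≤ D
    d≤D = farthest O P d d-distance

    f : Vertex G → Vec Bool d
    f = proj₁ (reach⇒realizes d O P (proj₁ d-distance))

    f-realizes : ∀ u v → T (adj G u v) → f u · f v ≡ arc O u v xor arc P u v
    f-realizes = proj₂ (reach⇒realizes d O P (proj₁ d-distance))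

    difference : ∀ u v → T (adj G u v) → arc O u v xor arc P u v ≡ σ u v
    difference u v uv with adj G u v
    ... | true = trans (cong (_xor (does (u <? v) xor σ u v)) (xor-identityʳ (does (u <? v))))
                       (xor-cancelˡ (does (u <? v)) (σ u v))

  -- A realisation of the difference of a farthest pair is a sequence of `s` inversions between
  -- them, and their distance is `D`.
  realizable⇒diameter≤ : ∀ {D} → IsDiameter G D → Realizable s (adj G) → D ≤ s
  realizable⇒diameter≤ {s} ((O , P , _ , shortest) , _) realizable =
    shortest s (realizes⇒reach s O P (realizable _ difference-sym))
    where
    difference-sym : Symmetric (λ u v → arc O u v xor arc P u v)
    difference-sym u v with T? (adj G u v)
    -- Exchanging the ends negates both arcs, which leaves their sum unchanged.
    ... | yes uv rewrite one-way O u v uv | one-way P u v uv =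
      sym (xor-annihilates-not (arc O u v) (arc P u v))
    ... | no ¬uv rewrite arc-nonadjacent O u v ¬uv | arc-nonadjacent P u v ¬uv
                       | arc-nonadjacent O v u (¬uv ∘ subst T (Graph.adj-sym G v u))
                       | arc-nonadjacent P v u (¬uv ∘ subst T (Graph.adj-sym G v u)) = refl

-- Colouring

Vec↔Fin : {A : Set} → A ↔ Fin m → ∀ n → Vec A n ↔ Fin (m ^ n)
Vec↔Fin A↔Fin zero    = mk↔ₛ′ (λ _ → zero) (λ _ → []) (λ { zero → refl }) (λ { [] → refl })
Vec↔Fin {A = A} A↔Fin (suc n) =
  ↔-sym *↔× ↔-∘ ((A↔Fin ×-↔ Vec↔Fin A↔Fin n) ↔-∘ uncons↔)
  where
  uncons↔ : Vec A (suc n) ↔ (A × Vec A n)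
  uncons↔ = mk↔ₛ′ (λ v → head v , tail v) (uncurry _∷_) (λ _ → refl) (λ { (_ ∷ _) → refl })

bits↔ : ∀ n → Vec Bool n ↔ Fin (2 ^ n)
bits↔ = Vec↔Fin (↔-sym 2↔Bool)

matrix↔ : ∀ m n → Vec (Vec Bool m) n ↔ Fin ((2 ^ m) ^ n)
matrix↔ m n = Vec↔Fin (bits↔ m) n

lookup-injective : {A : Set} (v w : Vec A n) → (∀ i → lookup v i ≡ lookup w i) → v ≡ w
lookup-injective v w eq =
  trans (sym (tabulate∘lookup v)) (trans (tabulate-cong eq) (tabulate∘lookup w))

-- Keeps the values of `τ` at pairs with the smaller vertex first. Applied to `flip τ` it keeps the
-- others, so the two results together determine `τ`.
symmetrize : Adjacency n → Adjacency n
symmetrize τ u v = if does (u <? v) then τ u v else τ v u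

symmetrize-sym : (τ : Adjacency n) → Symmetric (symmetrize τ)
symmetrize-sym τ u v with <-cmp u v
... | tri< p _ ¬q rewrite dec-true (u <? v) p | dec-false (v <? u) ¬q = refl
... | tri> ¬p _ q rewrite dec-false (u <? v) ¬p | dec-true (v <? u) q = refl
... | tri≈ _ refl _ = refl

-- Two realisations, one for each order of the ends, encode a labelling of the
-- ordered pairs.  Labelling (u , v) by the entry β u (c u v) of a matrix β
-- makes β recoverable from them.
saturated-bound : ∀ {A : Adjacency n} → Realizable t A → (c : Fin n → Fin n → Fin m) →
                  (∀ u a → ∃[ v ] T (A u v) × c u v ≡ a) →
                  (2 ^ m) ^ n ≤ (2 ^ (t + t)) ^ n
saturated-bound {n} {t} {m} {A} realizable c saturated =
  injective⇒≤ {f = Inverse.to (matrix↔ (t + t) n) ∘ encode ∘ Inverse.from (matrix↔ m n)}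
    (Injection.injective (↔⇒↣ (↔-sym (matrix↔ m n))) ∘ encode-injective ∘
     Injection.injective (↔⇒↣ (matrix↔ (t + t) n)))
  where
  label : Vec (Vec Bool m) n → Adjacency n
  label β u v = lookup (lookup β u) (c u v)

  up : ∀ β → Realizes t A (symmetrize (label β))
  up β = realizable _ (symmetrize-sym (label β))

  down : ∀ β → Realizes t A (symmetrize (flip (label β)))
  down β = realizable _ (symmetrize-sym (flip (label β)))

  code : ∀ β → Fin n → Vec Bool (t + t)
  code β u = proj₁ (up β) u ++ proj₁ (down β) u

  encode : Vec (Vec Bool m) n → Vec (Vec Bool (t + t)) n
  encode β = tabulate (code β)

  label-determined : ∀ β β′ → (∀ u → code β u ≡ code β′ u) →
                     ∀ u v → T (A u v) → label β u v ≡ label β′ u v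
  label-determined β β′ eq u v uv with up β | down β | up β′ | down β′ | eq u | eq v
  ... | f , f≡ | g , g≡ | f′ , f′≡ | g′ , g′≡ | equ | eqv
    with does (u <? v) | f≡ u v uv | g≡ u v uv | f′≡ u v uv | g′≡ u v uv
  -- The label of `(u , v)` sits in the `up` half of the codes if `u < v`, and in the `down` half
  -- otherwise.
  ... | true  | p | _ | q | _ = trans (sym p) (trans
    (cong₂ _·_ (++-injectiveˡ (f u) (f′ u) equ) (++-injectiveˡ (f v) (f′ v) eqv)) q)
  ... | false | _ | p | _ | q = trans (sym p) (trans
    (cong₂ _·_ (++-injectiveʳ (f u) (f′ u) equ) (++-injectiveʳ (f v) (f′ v) eqv)) q)

  encode-injective : ∀ {β β′} → encode β ≡ encode β′ → β ≡ β′
  encode-injective {β} {β′} eq = lookup-injective β β′ λ u →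
    lookup-injective (lookup β u) (lookup β′ u) λ a → entry u a (saturated u a)
    where
    code≡ : ∀ u → code β u ≡ code β′ u
    code≡ u = trans (sym (lookup∘tabulate (code β) u))
      (trans (cong (λ w → lookup w u) eq) (lookup∘tabulate (code β′) u))

    entry : ∀ u a → ∃[ v ] T (A u v) × c u v ≡ a →
            lookup (lookup β u) a ≡ lookup (lookup β′ u) a
    -- Saturation exhibits every matrix entry as the label of an adjacent pair.
    entry u _ (v , uv , refl) = label-determined β β′ code≡ u v uv

Colouring : ℕ → Adjacency n → Set
Colouring {n} m A = Σ[ c ∈ (Fin n → Fin m) ] (∀ u v → T (A u v) → c u ≢ c v)

restrict-realizable : ∀ {A : Adjacency (suc n)} k → Realizable t A →
                      Realizable t (λ u v → A (punchIn k u) (punchIn k v))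
-- No vertex remains, so there is nothing to retract `k` onto.
restrict-realizable {zero} k realizable σ σ-sym = (λ ()) , λ ()
restrict-realizable {suc n} {A = A} k realizable σ σ-sym =
  let f , f-realizes = realizable (λ u v → σ (r u) (r v)) (λ u v → σ-sym (r u) (r v)) in
  f ∘ punchIn k , λ u v uv → trans (f-realizes (punchIn k u) (punchIn k v) uv)
    (cong₂ σ (insertAt-punchIn id k zero u) (insertAt-punchIn id k zero v))
  where
  -- Labels are pulled back along a retraction of punchIn k.
  r : Fin (suc (suc n)) → Fin (suc n)
  r = insertAt id k zero

power-bound : ∀ a b n → a < b → ¬ (2 ^ b) ^ suc n ≤ (2 ^ a) ^ suc n
power-bound a b n a<b rewrite ℕ.^-*-assoc 2 a (suc n) | ℕ.^-*-assoc 2 b (suc n) =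
  ℕ.<⇒≱ (ℕ.^-monoʳ-< 2 (s≤s (s≤s z≤n)) (ℕ.*-monoˡ-< (suc n) a<b))

insertAt-punchOut : ∀ {A : Set} (g : Fin n → A) {k u} (x : A) (k≢u : k ≢ u) →
                    insertAt g k x u ≡ g (punchOut k≢u)
insertAt-punchOut g {k} x k≢u =
  trans (cong (insertAt g k x) (sym (punchIn-punchOut k≢u))) (insertAt-punchIn g k x _)

-- If no colouring of the graph minus a vertex k extends to k, then every k has
-- a neighbour of every colour.
colourable : ∀ n (A : Adjacency n) → Symmetric A → (∀ u → ¬ T (A u u)) →
             Realizable t A → t + t < m → Colouring m A
colourable zero A A-sym A-irrefl realizable t+t<m = (λ ()) , λ ()
colourable {t} {suc m} (suc n) A A-sym A-irrefl realizable t+t<m =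
  extend (any? λ k → any? λ a → ¬? (blocked? k a))
  where
  rest : ∀ k → Colouring (suc m) (λ u v → A (punchIn k u) (punchIn k v))
  rest k = colourable n (λ u v → A (punchIn k u) (punchIn k v)) (λ _ _ → A-sym _ _)
    (λ _ → A-irrefl _) (restrict-realizable {A = A} k realizable) t+t<m

  colour : Fin (suc n) → Fin (suc m) → Fin (suc n) → Fin (suc m)
  colour k a = insertAt (proj₁ (rest k)) k a

  Blocked : Fin (suc n) → Fin (suc m) → Set
  -- The colour `zero` given to `k` is a placeholder: `k` is not its own neighbour.
  Blocked k a = ∃[ v ] T (A k v) × colour k zero v ≡ a

  blocked? : ∀ k a → Dec (Blocked k a)
  blocked? k a = any? (λ v → T? (A k v) ×-dec (colour k zero v ≟ a))

  new : ∀ {k a v} → ¬ Blocked k a → k ≢ v → T (A k v) → colour k a k ≢ colour k a v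
  new {k} {a} {v} free k≢v kv eq = free (v , kv , (begin
    colour k zero v                ≡⟨ insertAt-punchOut (proj₁ (rest k)) zero k≢v ⟩
    proj₁ (rest k) (punchOut k≢v)  ≡⟨ insertAt-punchOut (proj₁ (rest k)) a k≢v ⟨
    colour k a v                   ≡⟨ eq ⟨
    colour k a k                   ≡⟨ insertAt-lookup (proj₁ (rest k)) k a ⟩
    a                              ∎))
    where open ≡-Reasoning

  proper : ∀ {k a} → ¬ Blocked k a → ∀ u v → T (A u v) → colour k a u ≢ colour k a v
  proper {k} {a} free u v uv with k ≟ u | k ≟ v
  ... | yes refl | yes refl = contradiction uv (A-irrefl k)
  ... | yes refl | no k≢v   = new free k≢v uv
  ... | no k≢u   | yes refl = new free k≢u (subst T (A-sym u k) uv) ∘ sym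
  ... | no k≢u   | no k≢v   = λ eq →
    proj₂ (rest k) (punchOut k≢u) (punchOut k≢v)
      (subst T (sym (cong₂ A (punchIn-punchOut k≢u) (punchIn-punchOut k≢v))) uv)
      (trans (sym (insertAt-punchOut (proj₁ (rest k)) a k≢u))
             (trans eq (insertAt-punchOut (proj₁ (rest k)) a k≢v)))

  extend : Dec (∃[ k ] ∃[ a ] ¬ Blocked k a) → Colouring (suc m) A
  extend (yes (k , a , free)) = colour k a , proper free
  -- Each `k` comes with its own colouring of the other vertices. These need not agree, since row
  -- `k` of the matrix is indexed by the colours of that colouring only.
  extend (no none)            = contradiction
    (saturated-bound {A = A} realizable (λ k → colour k zero)
      (λ k a → decidable-stable (blocked? k a) (λ free → none (k , a , free))))
    (power-bound (t + t) (suc m) n t+t<m)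

<2^[1+⌊log₂⌋] : ∀ n → n < 2 ^ suc ⌊log₂ n ⌋
<2^[1+⌊log₂⌋] n = ℕ.≰⇒> λ 2^≤n → ℕ.1+n≰n
  (subst (_≤ ⌊log₂ n ⌋) (⌊log₂[2^n]⌋≡n (suc ⌊log₂ n ⌋)) (⌊log₂⌋-mono-≤ 2^≤n))

-- Supplies the strict bound on the number of colours that `colourable` asks for, with colours that
-- are bit vectors.
n+n<2^[2+⌊log₂n⌋] : ∀ n → n + n < 2 ^ (2 + ⌊log₂ n ⌋)
n+n<2^[2+⌊log₂n⌋] n = subst (n + n <_) (cong (2 ^ suc ⌊log₂ n ⌋ +_) (sym (ℕ.+-identityʳ _)))
  (ℕ.+-mono-< (<2^[1+⌊log₂⌋] n) (<2^[1+⌊log₂⌋] n))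

-- Paths

-- The conditions on `toℕ` copy those of `first`, `next` and `last` in `PathStep`, so each field
-- answers one constructor. An unsubdivided edge, `k ≡ 0`, is left unconstrained here.
record Chain (k : ℕ) (start end : Vec Bool s)
             (α : Fin k → Bool) (β : Fin k → Fin k → Bool) (γ : Fin k → Bool) : Set where
  field
    node        : Fin k → Vec Bool s
    start-label : ∀ i → toℕ i ≡ 0 → start · node i ≡ α i
    step-label  : ∀ i j → toℕ j ≡ suc (toℕ i) → node i · node j ≡ β i j
    end-label   : ∀ i → suc (toℕ i) ≡ k → node i · end ≡ γ i

open Chain

empty-chain : ∀ {start end : Vec Bool s} {α β γ} → Chain 0 start end α β γ
empty-chain .node ()
empty-chain .start-label ()
empty-chain .step-label ()
empty-chain .end-label ()

-- Once `x` is placed it becomes the start of the remaining chain, with the first row of `β` as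
-- start labels; it meets `end` only if it is also the last node.
cons-chain : ∀ {start end : Vec Bool s} {α β γ} x → start · x ≡ α zero →
             (k ≡ 0 → x · end ≡ γ zero) →
             Chain k x end (β zero ∘ suc) (λ i j → β (suc i) (suc j)) (γ ∘ suc) →
             Chain (suc k) start end α β γ
cons-chain x p q c .node zero = x
cons-chain x p q c .node (suc i) = node c i
cons-chain x p q c .start-label zero _ = p
cons-chain x p q c .step-label zero (suc j) eq = start-label c j (ℕ.suc-injective eq)
cons-chain x p q c .step-label (suc i) (suc j) eq = step-label c i j (ℕ.suc-injective eq)
cons-chain x p q c .end-label zero eq = q (sym (ℕ.suc-injective eq))
cons-chain x p q c .end-label (suc i) eq = end-label c i (ℕ.suc-injective eq)

-- The leading 1 lets the first coordinate of a new vertex set its product with an old one. The two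
-- zeros hide the next two coordinates from old vertices, leaving them free for products between new
-- ones.
old : Vec Bool n → Vec Bool (3 + n)
old v = true ∷ false ∷ false ∷ v

-- A nonzero linear form on 𝔽₂² takes each value at two points, so one of them is nonzero. With a
-- single coordinate the value `false` would force zero.
new-dot : ∀ q₁ q₂ → T (q₁ ∨ q₂) → ∀ c →
          ∃[ x₁ ] ∃[ x₂ ] T (x₁ ∨ x₂) × (q₁ ∧ x₁) xor (q₂ ∧ x₂) ≡ c
new-dot true  true  _ true  = true  , false , _ , refl
new-dot true  true  _ false = true  , true  , _ , refl
new-dot true  false _ true  = true  , true  , _ , refl
new-dot true  false _ false = false , true  , _ , refl
new-dot false true  _ c     = true  , c     , _ , refl

chain-from-new : ∀ k (w : Vec Bool n) q₀ q₁ q₂ → T (q₁ ∨ q₂) → ∀ q α β γ →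
                 Chain k (q₀ ∷ q₁ ∷ q₂ ∷ q) (old w) α β γ
chain-from-new zero    w q₀ q₁ q₂ q≢0 q α β γ = empty-chain
chain-from-new (suc k) w q₀ q₁ q₂ q≢0 q α β γ
  -- The first coordinate is fixed as `γ zero`, which with a zero tail is the product with `old w`.
  -- The argument is what the middle coordinates must add to reach `α zero`; that they are again
  -- nonzero keeps the recursion going.
  with new-dot q₁ q₂ q≢0 ((q₀ ∧ γ zero) xor α zero)
... | x₁ , x₂ , x≢0 , eq = cons-chain (γ zero ∷ x₁ ∷ x₂ ∷ 𝟎) start-x (λ _ → x-end)
  (chain-from-new k w (γ zero) x₁ x₂ x≢0 𝟎 _ _ _)
  where
  open ≡-Reasoning
  start-x : (q₀ ∧ γ zero) xor ((q₁ ∧ x₁) xor ((q₂ ∧ x₂) xor (q · 𝟎))) ≡ α zero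
  start-x = begin
    (q₀ ∧ γ zero) xor ((q₁ ∧ x₁) xor ((q₂ ∧ x₂) xor (q · 𝟎)))
      ≡⟨ cong (λ y → (q₀ ∧ γ zero) xor ((q₁ ∧ x₁) xor y))
           (trans (cong ((q₂ ∧ x₂) xor_) (·-zeroʳ q)) (xor-identityʳ _)) ⟩
    (q₀ ∧ γ zero) xor ((q₁ ∧ x₁) xor (q₂ ∧ x₂))  ≡⟨ cong ((q₀ ∧ γ zero) xor_) eq ⟩
    (q₀ ∧ γ zero) xor ((q₀ ∧ γ zero) xor α zero) ≡⟨ xor-cancelˡ (q₀ ∧ γ zero) (α zero) ⟩
    α zero                                       ∎

  x-end : (γ zero ∷ x₁ ∷ x₂ ∷ 𝟎) · old w ≡ γ zero
  x-end = trans (·-comm (γ zero ∷ x₁ ∷ x₂ ∷ 𝟎) (old w))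
                (trans (cong (γ zero xor_) (·-zeroʳ w)) (xor-identityʳ (γ zero)))

chain-from-old : ∀ k (v w : Vec Bool n) → v ≢ w → ∀ α β γ → Chain k (old v) (old w) α β γ
chain-from-old zero v w v≢w α β γ = empty-chain
-- Both end labels constrain one vector: `x` is chosen so that its products with `v` and `w` differ
-- by the sum of the labels, and then `x₀` corrects both at once.
chain-from-old (suc zero) v w v≢w α β γ with ·-separates v w v≢w (α zero xor γ zero)
... | x , eq = cons-chain (x₀ ∷ false ∷ false ∷ x) (xor-cancelʳ (α zero) (v · x)) (λ _ → x-end)
  empty-chain
  where
  open ≡-Reasoning
  x₀ : Bool
  x₀ = α zero xor (v · x)

  x-end : (x₀ ∷ false ∷ false ∷ x) · old w ≡ γ zero
  x-end = begin
    (x₀ ∷ false ∷ false ∷ x) · old w       ≡⟨ ·-comm (x₀ ∷ false ∷ false ∷ x) (old w) ⟩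
    (α zero xor (v · x)) xor (w · x)       ≡⟨ xor-assoc (α zero) (v · x) (w · x) ⟩
    α zero xor ((v · x) xor (w · x))       ≡⟨ cong (α zero xor_) eq ⟩
    α zero xor (α zero xor γ zero)         ≡⟨ xor-cancelˡ (α zero) (γ zero) ⟩
    γ zero                                 ∎
-- The first of several new vertices is not joined to the end: its first coordinate meets the start
-- label, and the middle part `(1 , 0)` begins the nonzero invariant.
chain-from-old (suc (suc k)) v w v≢w α β γ =
  cons-chain (α zero ∷ true ∷ false ∷ 𝟎)
    (trans (cong (α zero xor_) (·-zeroʳ v)) (xor-identityʳ (α zero))) (λ ())
    (chain-from-new (suc k) w (α zero) true false _ 𝟎 _ _ _)

-- Labellings of the subdivision

subdivision-realizable : ∀ {G H} → IsSubdivision G H → Realizable t (adj G) →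
                         Colouring (2 ^ m) (adj G) → Realizable (3 + (m + t)) (adj H)
subdivision-realizable {t} {m} {G} {H} H-subdivides realizable (c , proper) σ σ-sym =
  position ∘ Inverse.from vertices , λ x y xy →
    trans (realizes (Inverse.from vertices x) (Inverse.from vertices y)
            (Equivalence.to (edges _ _)
              (subst T (sym (cong₂ (adj H) (to-from x) (to-from y))) xy)))
          (cong₂ σ (to-from x) (to-from y))
  where
  open IsSubdivision H-subdivides

  to-from : ∀ x → Inverse.to vertices (Inverse.from vertices x) ≡ x
  to-from = Inverse.strictlyInverseˡ vertices

  label : SubdividedVertex G len → SubdividedVertex G len → Bool
  label x y = σ (Inverse.to vertices x) (Inverse.to vertices y)

  h : Vertex G → Vec Bool m
  h = Inverse.from (bits↔ m) ∘ c

  h-proper : ∀ u v → T (adj G u v) → h u ≢ h v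
  h-proper u v uv = proper u v uv ∘ Injection.injective (↔⇒↣ (↔-sym (bits↔ m)))

  -- The product of the `old (h _)` parts is added in advance, so that it cancels in the full
  -- product on an unsubdivided edge.
  corrected : Realizes t (adj G) (λ u v → (old (h u) · old (h v)) xor label (inj₁ u) (inj₁ v))
  corrected = realizable _ (λ u v → cong₂ _xor_ (·-comm (old (h u)) (old (h v))) (σ-sym _ _))

  g : Vertex G → Vec Bool t
  g = proj₁ corrected

  chain : ∀ e → let open Edge e in
          Chain (len e) (old (h source ++ g source)) (old (h target ++ g target))
            (λ i → label (inj₁ source) (inj₂ (e , i)))
            (λ i j → label (inj₂ (e , i)) (inj₂ (e , j)))
            (λ i → label (inj₂ (e , i)) (inj₁ target))
  -- Adjacent vertices have different colours, so the end vectors differ whatever `g` is.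
  chain e = chain-from-old (len e) _ _
    (h-proper source target adjacent ∘ ++-injectiveˡ (h source) (h target)) _ _ _
    where open Edge e

  position : SubdividedVertex G len → Vec Bool (3 + (m + t))
  position (inj₁ u)       = old (h u ++ g u)
  position (inj₂ (e , i)) = node (chain e) i

  step-realizes : ∀ {x y} → PathStep G len x y → position x · position y ≡ label x y
  step-realizes (whole e _)      =
    -- `old (h u ++ g u)` computes to `old (h u) ++ g u`, so the product splits into the known part
    -- and the one realised by `g`.
    trans (·-++ (old (h source)) (old (h target)) (g source) (g target))
      (trans (cong ((old (h source) · old (h target)) xor_) (proj₂ corrected source target adjacent))
             (xor-cancelˡ (old (h source) · old (h target)) _))
    where open Edge e
  step-realizes (first e i i≡0)  = start-label (chain e) i i≡0
  step-realizes (next e i j j≡)  = step-label (chain e) i j j≡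
  step-realizes (last e i i≡)    = end-label (chain e) i i≡

  realizes : ∀ x y → SymClosure (PathStep G len) x y → position x · position y ≡ label x y
  realizes x y (fwd xy) = step-realizes xy
  realizes x y (bwd yx) =
    trans (·-comm (position x) (position y)) (trans (step-realizes yx) (σ-sym _ _))

diameter-subdivision≤ : ∀ {G H D E} → IsDiameter G D → IsDiameter H E → IsSubdivision G H →
                        E ≤ D + ⌊log₂ D ⌋ + 5
diameter-subdivision≤ {G} {H} {D} {E} G-diameter H-diameter H-subdivides =
  -- Three leading coordinates, `2 + ⌊log₂ D ⌋` for the colour and `D` for `g`.
  subst (E ≤_) (dimension D ⌊log₂ D ⌋)
    (realizable⇒diameter≤ {H} H-diameter (subdivision-realizable H-subdivides realizable colouring))
  where
  realizable : Realizable D (adj G)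
  realizable = diameter-realizable G-diameter

  colouring : Colouring (2 ^ (2 + ⌊log₂ D ⌋)) (adj G)
  colouring = colourable (order G) (adj G) (Graph.adj-sym G)
    (λ u → subst T (Graph.no-loop G u)) realizable (n+n<2^[2+⌊log₂n⌋] D)

  dimension : ∀ t l → 3 + ((2 + l) + t) ≡ t + l + 5
  dimension = solve 2 (λ t l → con 3 :+ ((con 2 :+ l) :+ t) := t :+ l :+ con 5) refl
    where open +-*-Solver

-- An edge makes `diam G` at least 1, and rounding the logarithm down gives a bound at least as
-- strong as the one with the real logarithm.
theorem1p5 : (G H : Graph) → Edge G → IsSubdivision G H →
    diam H ≤ diam G + ⌊log₂ diam G ⌋ + 5
theorem1p5 G H _ = diameter-subdivision≤ (proj₂ (diameter-exists {G})) (proj₂ (diameter-exists {H}))
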